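{- Let $\mathbb{M} = \langle W, \{\sim_i\}_{i \in G}, \{\leq_{i,w}\}_{i \in G}^{w \in W}, V\rangle$ and $\mathbb{M}' = \langle W', \{\sim'_i\}_{i \in G}, \{\leq'_{i,w'}\}_{i \in G}^{w' \in W'}, V'\rangle$ be epistemic plausibility models and let $Z \subseteq W \times W'$ be a relation. 1. If $\mathbb{M}$ and $\mathbb{M}'$ are uniform and locally connected, and $Z$ is a $\{K,B^+\}$-bisimulation, then for all $\varphi\in\mathcal{L}(K,B^+,B^c)$ and all $(w,w')\in Z$: $\mathbb{M},w\models\varphi\Leftrightarrow\mathbb{M}',w'\models\varphi$. 2. If $\mathbb{M}$ and $\mathbb{M}'$ are uniform, locally connected and image-finite, then for all states $w\in W$ and $w'\in W'$: if $w$ and $w'$ are $\{K,B^+\}$-bisimilar, then they are $\{K,B^c\}$-bisimilar as well.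
   Context: Fix a non-empty set $G$ of agents and a countably infinite set $Prop$ of proposition letters. Models. An epistemic plausibility model is a structure $\mathbb{M} = \langle W, \{\sim_i\}_{i \in G}, \{\leq_{i,w}\}_{i \in G}^{w \in W}, V\rangle$ where $W$ is a non-empty set of states, each $\sim_i \subseteq W\times W$ is an equivalence relation, each $\leq_{i,w} \subseteq W \times W$ is a well-founded pre-order, and $V : Prop \to \wp(W)$. For $X \subseteq W$, $\mathrm{Min}_{\leq_{i,w}}(X) := \{x \in X \mid \forall y \in X: y \leq_{i,w} x \Rightarrow x \leq_{i,w} y\}$. A well-founded pre-order is a reflexive transitive relation (not necessarily total) such that $\mathrm{Min}_{\leq_{i,w}}(X) \neq \emptyset$ for every non-empty $X \subseteq W$. Write $[w]_{\sim_i} := \{v \in W \mid w \sim_i v\}$. The model is uniform iff for all $i\in G$ and $w,v\in W$: if $w\sim_i v$ then $\leq_{i,w}=\leq_{i,v}$. It is locally connected iff for all $i\in G$ and $w,v\in W$: if $w\sim_i v$ then $w\leq_{i,w}v$ or $v\leq_{i,w}w$. It is image-finite if $[w]_{\sim_i}$ is finite for all $i\in G$ and $w\in W$. Languages and semantics. $\mathcal{L}(K,B^+,B^c)$ is built from proposition letters $p\in Prop$ using $\neg$, $\wedge$, and (for all $i\in G$) the operators $K_i\varphi$, $B_i^+\varphi$ and $B_i^\alpha\varphi$ ($\alpha,\varphi$ both formulas of the language); $\mathcal{L}(K,B^c)$ is its fragment without the $B_i^+$. Proposition letters (via $V$) and Booleans are interpreted as usual; $[\![\alpha]\!]^{\mathbb{M}}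 := \{w \in W \mid \mathbb{M},w\models\alpha\}$; $\mathbb{M},w \models K_i\varphi$ iff $\forall v \in [w]_{\sim_i}: \mathbb{M},v\models\varphi$; $\mathbb{M},w \models B_i^\alpha\varphi$ iff $\forall v \in \mathrm{Min}_{\leq_{i,w}}([\![\alpha]\!]^{\mathbb{M}} \cap [w]_{\sim_i}): \mathbb{M},v\models\varphi$; $\mathbb{M},w \models B_i^+\varphi$ iff $\forall v \in [w]_{\sim_i}: v \leq_{i,w} w \Rightarrow \mathbb{M},v\models\varphi$. Bisimulations. Let $Z\subseteq W\times W'$. In each case the "atoms" clause is required: if $(w,w')\in Z$ then for all $p\in Prop$, $w\in V(p)\Leftrightarrow w'\in V'(p)$. In addition, for all $i\in G$: - $Z$ is a $K$-bisimulation iff: if $(w,w')\in Z$ and $w\sim_i v$, then there is $v'\in W'$ with $(v,v')\in Z$ and $w'\sim'_i v'$; and if $(w,w')\in Z$ and $w'\sim'_i v'$, then there is $v \in W$ with $(v,v')\in Z$ and $w\sim_i v$. - $Z$ is a $B^+$-bisimulation iff: if $(w,w')\in Z$, $w\sim_i v$ and $v\leq_{i,w} w$, then there is $v'\in W'$ with $(v,v')\in Z$, $w'\sim'_i v'$ and $v'\leq'_{i,w'}w'$; and if $(w,w')\in Z$, $w'\sim'_i v'$ and $v'\leq'_{i,w'}w'$, then there is $v\in W$ with $(v,v')\in Z$, $w\sim_i v$ and $v\leq_{i,w}w$. - $Z$ is a $\{K,B^+\}$-bisimulation iff it is both a $K$-bisimulation and a $B^+$-bisimulation. - $Z$ is a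 $\{K,B^c\}$-bisimulation iff it is a $K$-bisimulation and for all formulas $\alpha\in\mathcal{L}(K,B^c)$: if $(w,w')\in Z$ and $v\in \mathrm{Min}_{\leq_{i,w}}([\![\alpha]\!]^{\mathbb{M}}\cap[w]_{\sim_i})$, then there is $v'\in W'$ with $(v,v')\in Z$ and $v'\in \mathrm{Min}_{\leq'_{i,w'}}([\![\alpha]\!]^{\mathbb{M}'}\cap[w']_{\sim'_i})$; and if $(w,w')\in Z$ and $v'\in \mathrm{Min}_{\leq'_{i,w'}}([\![\alpha]\!]^{\mathbb{M}'}\cap[w']_{\sim'_i})$, then there is $v\in W$ with $(v,v')\in Z$ and $v\in \mathrm{Min}_{\leq_{i,w}}([\![\alpha]\!]^{\mathbb{M}}\cap[w]_{\sim_i})$. States $w\in W$, $w'\in W'$ are bisimilar (of a given type) if there is a bisimulation $Z$ of that type with $(w,w')\in Z$. -}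

module Defs where

open import Level using (Level; suc; _⊔_)
open import Data.List using (List)
open import Data.List.Membership.Propositional using () renaming (_∈_ to _∈ₗ_)
open import Data.Product using (_×_; ∃-syntax; Σ-syntax)
open import Data.Sum using (_⊎_)
import Function.Bundles as Fun
open import Relation.Binary using (Rel; REL; IsEquivalence; IsPreorder; _⇔_)
open import Relation.Binary.PropositionalEquality using (_≡_)
open import Relation.Nullary using (¬_)
open import Relation.Unary using (Pred; _∈_; _∩_; Satisfiable)

Min : ∀ {ℓ} {W : Set ℓ} → Rel W ℓ → Pred W ℓ → Pred W ℓ
Min _≤_ X x = x ∈ X × (∀ y → y ∈ X → y ≤ x → x ≤ y)

-- Subsets of W are predicates into the universe that also contains W, the
-- relations and the valuation; the truth set of every formula is one of them.
-- Non-emptiness is inhabitedness, both for X and for Min _≤_ X.  This is not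
-- the library's WellFounded, which no reflexive relation on a non-empty type
-- satisfies.  As X may be an undecidable predicate, minimal is constructively
-- strong: an order with a strict pair satisfies it only under excluded middle.
-- Classically it is the usual minimal-element condition.
record IsWellFoundedPreorder {ℓ} {W : Set ℓ} (_≤_ : Rel W ℓ) : Set (suc ℓ) where
  field
    isPreorder : IsPreorder _≡_ _≤_
    minimal    : (X : Pred W ℓ) → Satisfiable X → Satisfiable (Min _≤_ X)

record Model {g p} (G : Set g) (Atom : Set p) (ℓ : Level) : Set (g ⊔ p ⊔ suc ℓ) where
  field
    W               : Set ℓ
    nonEmpty        : W
    ∼               : G → Rel W ℓ
    ≤               : G → W → Rel W ℓ
    V               : Atom → Pred W ℓ
    ∼-isEquivalence : ∀ i → IsEquivalence (∼ i)
    ≤-isWellFounded : ∀ i w → IsWellFoundedPreorder (≤ i w)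

-- B i α φ is the conditional belief Bᵢ^α φ.
data Formula {g p} (G : Set g) (Atom : Set p) : Set (g ⊔ p) where
  atom : Atom → Formula G Atom
  neg  : Formula G Atom → Formula G Atom
  _∧_  : Formula G Atom → Formula G Atom → Formula G Atom
  K    : G → Formula G Atom → Formula G Atom
  B⁺   : G → Formula G Atom → Formula G Atom
  B    : G → Formula G Atom → Formula G Atom → Formula G Atom

-- Membership in the fragment with K and Bᶜ only: B⁺ occurs nowhere, not even
-- in the condition of a conditional belief.
data B⁺-Free {g p} {G : Set g} {Atom : Set p} : Formula G Atom → Set (g ⊔ p) where
  atom : ∀ a → B⁺-Free (atom a)
  neg  : ∀ {φ} → B⁺-Free φ → B⁺-Free (neg φ)
  _∧_  : ∀ {φ ψ} → B⁺-Free φ → B⁺-Free ψ → B⁺-Free (φ ∧ ψ)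
  K    : ∀ i {φ} → B⁺-Free φ → B⁺-Free (K i φ)
  B    : ∀ i {α φ} → B⁺-Free α → B⁺-Free φ → B⁺-Free (B i α φ)

infix 4 _,_⊨_

_,_⊨_ : ∀ {g p ℓ} {G : Set g} {Atom : Set p} (M : Model G Atom ℓ) →
        Model.W M → Formula G Atom → Set ℓ
M , w ⊨ atom a  = w ∈ Model.V M a
M , w ⊨ neg φ   = ¬ (M , w ⊨ φ)
M , w ⊨ (φ ∧ ψ) = (M , w ⊨ φ) × (M , w ⊨ ψ)
M , w ⊨ K i φ   = ∀ v → Model.∼ M i w v → M , v ⊨ φ
M , w ⊨ B⁺ i φ  = ∀ v → Model.∼ M i w v → Model.≤ M i w v w → M , v ⊨ φ
M , w ⊨ B i α φ =
  ∀ v → v ∈ Min (Model.≤ M i w) ((λ u → M , u ⊨ α) ∩ Model.∼ M i w) → M , v ⊨ φ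

⟦_⟧ : ∀ {g p ℓ} {G : Set g} {Atom : Set p} →
      Formula G Atom → (M : Model G Atom ℓ) → Pred (Model.W M) ℓ
⟦ α ⟧ M w = M , w ⊨ α

module _ {g p ℓ : Level} {G : Set g} {Atom : Set p} (M : Model G Atom ℓ) where
  open Model M

  Uniform : Set (g ⊔ ℓ)
  Uniform = ∀ i w v → ∼ i w v → ≤ i w ⇔ ≤ i v

  LocallyConnected : Set (g ⊔ ℓ)
  LocallyConnected = ∀ i w v → ∼ i w v → ≤ i w w v ⊎ ≤ i w v w

  -- Each class is listed exactly by some finite list, repetitions allowed.
  ImageFinite : Set (g ⊔ ℓ)
  ImageFinite = ∀ i w → Σ[ xs ∈ List W ] (∀ v → v ∈ₗ xs Fun.⇔ ∼ i w v)

module _ {g p ℓ ℓ′ r : Level} {G : Set g} {Atom : Set p}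
         (M : Model G Atom ℓ) (M′ : Model G Atom ℓ′) where
  open Model M
  open Model M′ using () renaming (W to W′; ∼ to ∼′; ≤ to ≤′; V to V′)

  AtomsAgree : REL W W′ r → Set (p ⊔ ℓ ⊔ ℓ′ ⊔ r)
  AtomsAgree Z = ∀ {w w′} → Z w w′ → ∀ a → w ∈ V a Fun.⇔ w′ ∈ V′ a

  record IsKBisimulation (Z : REL W W′ r) : Set (g ⊔ p ⊔ ℓ ⊔ ℓ′ ⊔ r) where
    field
      atoms : AtomsAgree Z
      forth : ∀ i {w w′ v} → Z w w′ → ∼ i w v →
              ∃[ v′ ] Z v v′ × ∼′ i w′ v′
      back  : ∀ i {w w′ v′} → Z w w′ → ∼′ i w′ v′ →
              ∃[ v ] Z v v′ × ∼ i w v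

  record IsB⁺Bisimulation (Z : REL W W′ r) : Set (g ⊔ p ⊔ ℓ ⊔ ℓ′ ⊔ r) where
    field
      atoms : AtomsAgree Z
      forth : ∀ i {w w′ v} → Z w w′ → ∼ i w v → ≤ i w v w →
              ∃[ v′ ] Z v v′ × ∼′ i w′ v′ × ≤′ i w′ v′ w′
      back  : ∀ i {w w′ v′} → Z w w′ → ∼′ i w′ v′ → ≤′ i w′ v′ w′ →
              ∃[ v ] Z v v′ × ∼ i w v × ≤ i w v w

  IsKB⁺Bisimulation : REL W W′ r → Set (g ⊔ p ⊔ ℓ ⊔ ℓ′ ⊔ r)
  IsKB⁺Bisimulation Z = IsKBisimulation Z × IsB⁺Bisimulation Z

  record IsKBᶜBisimulation (Z : REL W W′ r) : Set (g ⊔ p ⊔ ℓ ⊔ ℓ′ ⊔ r) where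
    field
      isKBisimulation : IsKBisimulation Z
      forth : ∀ i α → B⁺-Free α → ∀ {w w′ v} → Z w w′ →
              v ∈ Min (≤ i w) (⟦ α ⟧ M ∩ ∼ i w) →
              ∃[ v′ ] Z v v′ × v′ ∈ Min (≤′ i w′) (⟦ α ⟧ M′ ∩ ∼′ i w′)
      back  : ∀ i α → B⁺-Free α → ∀ {w w′ v′} → Z w w′ →
              v′ ∈ Min (≤′ i w′) (⟦ α ⟧ M′ ∩ ∼′ i w′) →
              ∃[ v ] Z v v′ × v ∈ Min (≤ i w) (⟦ α ⟧ M ∩ ∼ i w)

-- Bisimilarity quantifies over relations Z in an explicitly given universe r.
module _ {g p ℓ ℓ′ : Level} {G : Set g} {Atom : Set p} (r : Level)
         (M : Model G Atom ℓ) (M′ : Model G Atom ℓ′) where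
  open Model M using (W)
  open Model M′ using () renaming (W to W′)

  KB⁺Bisimilar : W → W′ → Set (g ⊔ p ⊔ ℓ ⊔ ℓ′ ⊔ suc r)
  KB⁺Bisimilar w w′ =
    Σ[ Z ∈ REL W W′ r ] IsKB⁺Bisimulation M M′ Z × Z w w′

  KBᶜBisimilar : W → W′ → Set (g ⊔ p ⊔ ℓ ⊔ ℓ′ ⊔ suc r)
  KBᶜBisimilar w w′ =
    Σ[ Z ∈ REL W W′ r ] IsKBᶜBisimulation M M′ Z × Z w w′

{-# OPTIONS --safe #-}
-- Over uniform models, a {K,B⁺}-bisimulation matches the minimal elements of
-- every pair of corresponding sets.  If v′ is minimal in X′ ∩ [w′], take m minimal
-- in X ∩ [w] and a partner m′ of m.  Local connectedness and the minimality of v′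
-- give v′ ≤′ m′, so the back clause for B⁺ at (m , m′) yields a partner v ≤ m of v′,
-- which is minimal since m is.  Starting from m, rather than from an arbitrary
-- partner of v′, is essential: v′ may also have partners that are not minimal.
module Submission where

open import Defs
open import Data.Nat using (ℕ)
open import Data.Product using (_×_; _,_; proj₁; proj₂; ∃-syntax)
open import Data.Sum using (inj₁; inj₂)
open import Function.Base using (flip; _∘_)
open import Function.Bundles using (_⇔_; _↔_; mk⇔; Equivalence)
open import Function.Construct.Symmetry using (⇔-sym)
open import Level using (Level)
open import Relation.Binary using (Rel; REL; IsEquivalence; IsPreorder)
open import Relation.Unary using (Pred; _∈_; _∩_)

open Equivalence using (to; from)

-- Whatever in X lies below v also lies below m, so minimality of m puts m, and with it v, below
-- that element.
Min-downward : ∀ {ℓ} {W : Set ℓ} {_≤_ : Rel W ℓ} {X : Pred W ℓ} {m v : W} →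
               (∀ {x y z} → x ≤ y → y ≤ z → x ≤ z) →
               m ∈ Min _≤_ X → v ∈ X → v ≤ m → v ∈ Min _≤_ X
Min-downward trans (_ , m-min) v∈X v≤m =
  v∈X , λ y y∈X y≤v → trans v≤m (m-min y y∈X (trans y≤v v≤m))

module _ {g p ℓ} {G : Set g} {Atom : Set p} (M : Model G Atom ℓ) where
  open Model M

  -- `conn` compares v and u only in the order at v. Uniformity along w ∼ v carries the comparison
  -- to the order at w, where minimality of v reverses u ≤ v.
  Min-least : Uniform M → LocallyConnected M → ∀ i {X : Pred W ℓ} {w v u} →
              v ∈ Min (≤ i w) (X ∩ ∼ i w) → u ∈ X ∩ ∼ i w → ≤ i w v u
  Min-least uni conn i {w = w} {v} {u} ((_ , w∼v) , v-min) (u∈X , w∼u)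
    with conn i v u (IsEquivalence.trans (∼-isEquivalence i)
                 (IsEquivalence.sym (∼-isEquivalence i) w∼v) w∼u)
  ... | inj₁ v≤u = proj₂ (uni i w v w∼v) v≤u
  ... | inj₂ u≤v = v-min u (u∈X , w∼u) (proj₂ (uni i w v w∼v) u≤v)

module _ {g p ℓ ℓ′ r : Level} {G : Set g} {Atom : Set p}
         {M : Model G Atom ℓ} {M′ : Model G Atom ℓ′} where
  open Model M
  open Model M′ using () renaming
    (W to W′; ∼ to ∼′; ≤ to ≤′; ∼-isEquivalence to ∼′-isEquivalence)

  -- The clauses come in mirrored pairs, so an argument given in one direction yields the other when
  -- applied to `flip Z`.
  KB⁺-flip : {Z : REL W W′ r} → IsKB⁺Bisimulation M M′ Z →
             IsKB⁺Bisimulation M′ M (flip Z)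
  KB⁺-flip (k , b) =
    record { atoms = λ z a → ⇔-sym (K′.atoms z a) ; forth = λ i → K′.back i ; back = λ i → K′.forth i } ,
    record { atoms = λ z a → ⇔-sym (B′.atoms z a) ; forth = λ i → B′.back i ; back = λ i → B′.forth i }
    where
    module K′ = IsKBisimulation k
    module B′ = IsB⁺Bisimulation b

  -- Working with arbitrary sets matched along Z, rather than truth sets, lets the induction on
  -- formulas apply this with its hypothesis for the condition α.
  Min-back : Uniform M → Uniform M′ → LocallyConnected M′ →
             {Z : REL W W′ r} → IsKB⁺Bisimulation M M′ Z →
             {X : Pred W ℓ} {X′ : Pred W′ ℓ′} →
             (∀ {u u′} → Z u u′ → u ∈ X ⇔ u′ ∈ X′) →
             ∀ i {w w′ v′} → Z w w′ → v′ ∈ Min (≤′ i w′) (X′ ∩ ∼′ i w′) →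
             ∃[ v ] Z v v′ × v ∈ Min (≤ i w) (X ∩ ∼ i w)
  Min-back uni uni′ conn′ {Z} (k , b) {X} {X′} agree i {w} {w′} {v′}
           zw ((v′∈X′ , w′∼v′) , v′-min)
    -- The partner u only shows that X ∩ [w] is inhabited, as `minimal` requires.
    with u , zu , w∼u ← IsKBisimulation.back k i zw w′∼v′
    with m , (m∈X , w∼m) , m-min ←
      IsWellFoundedPreorder.minimal (≤-isWellFounded i w) (X ∩ ∼ i w)
        (u , from (agree zu) v′∈X′ , w∼u)
    with m′ , zm , w′∼m′ ← IsKBisimulation.forth k i zw w∼m
    with v , zv , m∼v , v≤m ←
      IsB⁺Bisimulation.back b i zm
        (IsEquivalence.trans (∼′-isEquivalence i)
          (IsEquivalence.sym (∼′-isEquivalence i) w′∼m′) w′∼v′)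
        -- The clause at (m , m′) speaks of the order at m′, while v′ ≤′ m′ is obtained in the order
        -- at w′.
        (proj₁ (uni′ i w′ m′ w′∼m′)
          (Min-least M′ uni′ conn′ i ((v′∈X′ , w′∼v′) , v′-min)
            (to (agree zm) m∈X , w′∼m′)))
    = v , zv ,
      Min-downward
        (IsPreorder.trans (IsWellFoundedPreorder.isPreorder (≤-isWellFounded i w)))
        ((m∈X , w∼m) , m-min)
        (from (agree zv) v′∈X′ , IsEquivalence.trans (∼-isEquivalence i) w∼m m∼v)
        (proj₂ (uni i w m w∼m) v≤m)

-- Mutual with `invariant`: negation reverses the direction, and conditional belief needs the truth
-- sets of α to match both ways.
preserves : ∀ {g p ℓ ℓ′ r} {G : Set g} {Atom : Set p}
            {M : Model G Atom ℓ} {M′ : Model G Atom ℓ′} →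
            Uniform M → LocallyConnected M → Uniform M′ → LocallyConnected M′ →
            {Z : REL (Model.W M) (Model.W M′) r} → IsKB⁺Bisimulation M M′ Z →
            ∀ φ {w w′} → Z w w′ → M , w ⊨ φ → M′ , w′ ⊨ φ
invariant : ∀ {g p ℓ ℓ′ r} {G : Set g} {Atom : Set p}
            {M : Model G Atom ℓ} {M′ : Model G Atom ℓ′} →
            Uniform M → LocallyConnected M → Uniform M′ → LocallyConnected M′ →
            {Z : REL (Model.W M) (Model.W M′) r} → IsKB⁺Bisimulation M M′ Z →
            ∀ φ {w w′} → Z w w′ → (M , w ⊨ φ) ⇔ (M′ , w′ ⊨ φ)

preserves uni conn uni′ conn′ bis (atom a) z h =
  to (IsKBisimulation.atoms (proj₁ bis) z a) h
preserves uni conn uni′ conn′ bis (neg φ) z h =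
  h ∘ preserves uni′ conn′ uni conn (KB⁺-flip bis) φ z
preserves uni conn uni′ conn′ bis (φ ∧ ψ) z (h , k) =
  preserves uni conn uni′ conn′ bis φ z h , preserves uni conn uni′ conn′ bis ψ z k
preserves uni conn uni′ conn′ bis (K i φ) z h v′ w′∼v′ =
  let v , zv , w∼v = IsKBisimulation.back (proj₁ bis) i z w′∼v′
  in preserves uni conn uni′ conn′ bis φ zv (h v w∼v)
preserves uni conn uni′ conn′ bis (B⁺ i φ) z h v′ w′∼v′ v′≤w′ =
  let v , zv , w∼v , v≤w = IsB⁺Bisimulation.back (proj₂ bis) i z w′∼v′ v′≤w′
  in preserves uni conn uni′ conn′ bis φ zv (h v w∼v v≤w)
preserves uni conn uni′ conn′ bis (B i α φ) z h v′ v′-min =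
  let v , zv , v-min =
        Min-back uni uni′ conn′ bis (invariant uni conn uni′ conn′ bis α) i z v′-min
  in preserves uni conn uni′ conn′ bis φ zv (h v v-min)

invariant uni conn uni′ conn′ bis φ z =
  mk⇔ (preserves uni conn uni′ conn′ bis φ z)
      (preserves uni′ conn′ uni conn (KB⁺-flip bis) φ z)

-- The same Z serves: by invariance it matches the truth sets of every α, which is what `Min-back`
-- asks for.
KB⁺⇒KBᶜ : ∀ {g p ℓ ℓ′ r} {G : Set g} {Atom : Set p}
          {M : Model G Atom ℓ} {M′ : Model G Atom ℓ′} →
          Uniform M → LocallyConnected M → Uniform M′ → LocallyConnected M′ →
          {Z : REL (Model.W M) (Model.W M′) r} →
          IsKB⁺Bisimulation M M′ Z → IsKBᶜBisimulation M M′ Z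
KB⁺⇒KBᶜ uni conn uni′ conn′ bis = record
  { isKBisimulation = proj₁ bis
  ; forth = λ i α _ →
      Min-back uni′ uni conn (KB⁺-flip bis)
        (invariant uni′ conn′ uni conn (KB⁺-flip bis) α) i
  ; back  = λ i α _ →
      Min-back uni uni′ conn′ bis (invariant uni conn uni′ conn′ bis α) i
  }

theorem28 : ∀ {g p ℓ ℓ′ r} (G : Set g) (Atom : Set p) → G → ℕ ↔ Atom →
    (M : Model G Atom ℓ) (M′ : Model G Atom ℓ′) (Z : REL (Model.W M) (Model.W M′) r) →
    (Uniform M → LocallyConnected M →
    Uniform M′ → LocallyConnected M′ →
    IsKB⁺Bisimulation M M′ Z →
    ∀ (φ : Formula G Atom) w w′ → Z w w′ → (M , w ⊨ φ) ⇔ (M′ , w′ ⊨ φ))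
    ×
    (Uniform M → LocallyConnected M → ImageFinite M →
    Uniform M′ → LocallyConnected M′ → ImageFinite M′ →
    ∀ w w′ → KB⁺Bisimilar r M M′ w w′ → KBᶜBisimilar r M M′ w w′)
theorem28 G Atom _ _ M M′ Z =
  (λ uni conn uni′ conn′ bis φ w w′ → invariant uni conn uni′ conn′ bis φ) ,
  (λ uni conn _ uni′ conn′ _ w w′ (Z₁ , bis , z) →
    Z₁ , KB⁺⇒KBᶜ uni conn uni′ conn′ bis , z)
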